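{- For fixed $n$, the small selective height of the set of all not strongly $n$-divisible words over an $l$-letter alphabet, with respect to the set $Z$ of non-cyclic words of length $2$, is greater than $$\Psi(n,l)=\frac{(l-2^{n-1})(n-2)(n-3)}{2}.$$
   Context: Words are over a finite alphabet $a_1<a_2<\dots<a_l$ and are compared lexicographically; two words are incomparable if one of them is a prefix of the other, and comparable otherwise. A word $u$ is non-cyclic if it is not of the form $v^k$ with an integer $k>1$. Two words are strongly comparable if any cyclic shift of the first is comparable with any cyclic shift of the second (for words of equal length: they are not cyclic shifts of each other). Subword means contiguous factor. Throughout the threshold is $k=2n$. Let $Z$ be a set of non-cyclic words of one fixed length. Strong $n$-divisibility (with respect to $Z$): a word $W$ is strongly $n$-divisible if $W=W_0W_1\cdots W_n$, where the subwords $W_1,\dots,W_n$ are in lexicographically decreasing order ($W_1>W_2>\dots>W_n$) and each $W_i$, $1\le i\le n$, begins with $z_i^{k}$ for some $z_i\in Z$, all the $z_i$ being distinct. Small selective height (with threshold $k$) of a word $W$ over $Z$: the maximal number $h$ such that $W$ contains $h$ pairwise disjoint subwords of the form $z^m$ with $z\in Z$, $m>k$, whose periods $z$ are pairwise not cyclic shifts of each other (i.e. they represent different classes of words up to cyclic shift). The small selective height of a set of words over $Z$ is the supremum of the small selective heights of its elements.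
   Formalization: The formal statement assumes n ≥ 2 and l ≥ 2; for n = 1 and l ≥ 1 the claim is false (the height is 0 while Ψ(1,l) = l−1), and for l ≤ 1 the set Z is empty, so the claim fails for n = 2, 3 and is only 0 > negative for n ≥ 4. -}

module Defs where

open import Data.Fin as Fin using (Fin)
open import Data.Integer as ℤ using (ℤ; +_; -[1+_])
import Data.Integer.Properties as ℤ
open import Data.List using (List; _++_; concat; length; replicate; tabulate)
open import Data.List.Relation.Binary.Lex.Strict using (Lex-<)
open import Data.List.Relation.Binary.Prefix.Heterogeneous using (Prefix)
open import Data.Nat as ℕ using (ℕ; zero; suc; s≤s)
import Data.Nat.Properties as ℕ
open import Data.Product using (∃; ∃₂; _×_; _,_)
open import Data.Rational.Unnormalised as ℚᵘ using (ℚᵘ; mkℚᵘ; *<*; *≤*)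
import Data.Rational.Unnormalised.Properties as ℚᵘ
open import Data.Unit using (⊤; tt)
open import Function.Definitions using (Injective)
open import Relation.Binary.PropositionalEquality using (_≡_; _≢_; sym; subst)
open import Relation.Binary.Construct.Add.Supremum.NonStrict ℕ._≤_
  using (_≤⁺_; [_])
open import Relation.Nullary using (¬_)
open import Relation.Nullary.Construct.Add.Supremum using (_⁺; ⊤⁺; [_])

Word : ℕ → Set
Word l = List (Fin l)

private variable
  l : ℕ

infix 4 _⊑_ _≺_
infixr 8 _^ʷ_

_^ʷ_ : Word l → ℕ → Word l
v ^ʷ k = concat (replicate k v)

_⊑_ : Word l → Word l → Set
_⊑_ = Prefix _≡_

Comparable : Word l → Word l → Set
Comparable u v = ¬ u ⊑ v × ¬ v ⊑ u

-- Lex-< places a proper prefix below its extensions; here such words are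
-- incomparable, so comparability is required separately.
_≺_ : Word l → Word l → Set
u ≺ v = Comparable u v × Lex-< _≡_ Fin._<_ u v

NonCyclic : Word l → Set
NonCyclic u = ¬ (∃₂ λ v k → 1 ℕ.< k × u ≡ v ^ʷ k)

NonCyclicOfLength : ℕ → Word l → Set
NonCyclicOfLength d z = NonCyclic z × length z ≡ d

CyclicShift : Word l → Word l → Set
CyclicShift u v = ∃₂ λ a b → u ≡ a ++ b × v ≡ b ++ a

-- The factors W₁, …, Wₙ are indexed from 0, as part i for i : Fin n.
record StronglyDivisible (Z : Word l → Set) (k n : ℕ) (W : Word l) : Set where
  field
    head          : Word l
    part          : Fin n → Word l
    period        : Fin n → Word l
    factorization : W ≡ head ++ concat (tabulate part)
    decreasing    : ∀ {i j} → i Fin.< j → part j ≺ part i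
    period∈Z      : ∀ i → Z (period i)
    begins        : ∀ i → period i ^ʷ k ⊑ part i
    distinct      : Injective _≡_ _≡_ period

-- h pairwise disjoint occurrences of powers, listed from left to right:
-- W = gap₀ z₀^m₀ gap₁ z₁^m₁ ⋯ tail.
record Selection (Z : Word l → Set) (k : ℕ) (W : Word l) (h : ℕ) : Set where
  field
    gap           : Fin h → Word l
    period        : Fin h → Word l
    exponent      : Fin h → ℕ
    tail          : Word l
    factorization :
      W ≡ concat (tabulate λ i → gap i ++ period i ^ʷ exponent i) ++ tail
    period∈Z      : ∀ i → Z (period i)
    large         : ∀ i → k ℕ.< exponent i
    inequivalent  : ∀ {i j} → i ≢ j → ¬ CyclicShift (period i) (period j)

IsSmallSelectiveHeight : (Z : Word l → Set) (k : ℕ) (W : Word l) → ℕ → Set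
IsSmallSelectiveHeight Z k W h =
  Selection Z k W h × (∀ h′ → Selection Z k W h′ → h′ ℕ.≤ h)

SmallSelectiveHeights : (Z : Word l → Set) (k : ℕ) (S : Word l → Set) → ℕ → Set
SmallSelectiveHeights Z k S h = ∃ λ W → S W × IsSmallSelectiveHeight Z k W h

infix 4 _<sup_ _<∞_

fromℕ : ℕ → ℚᵘ
fromℕ h = + h ℚᵘ./ 1

-- q < sup P, the supremum being taken in ℕ ∪ {∞}. The supremum of a set of
-- naturals need not be computable as an element of ℕ ∪ {∞}, so the strict
-- inequality is given by a member of P above q. The lemmas <sup⇒< and <⇒<sup
-- relate this to the least upper bound.
_<sup_ : ℚᵘ → (ℕ → Set) → Set
q <sup P = ∃ λ h → P h × q ℚᵘ.< fromℕ h

IsSupremum : (ℕ → Set) → ℕ ⁺ → Set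
IsSupremum P s =
  (∀ h → P h → [ h ] ≤⁺ s) × (∀ t → (∀ h → P h → [ h ] ≤⁺ t) → s ≤⁺ t)

_<∞_ : ℚᵘ → ℕ ⁺ → Set
q <∞ [ m ] = q ℚᵘ.< fromℕ m
q <∞ ⊤⁺    = ⊤

private
  fromℕ-mono-≤ : ∀ {a b} → a ℕ.≤ b → fromℕ a ℚᵘ.≤ fromℕ b
  fromℕ-mono-≤ a≤b = *≤* (ℤ.*-monoʳ-≤-nonNeg (+ 1) (ℤ.+≤+ a≤b))

  fromℕ-cancel-< : ∀ {a b} → fromℕ a ℚᵘ.< fromℕ b → a ℕ.< b
  fromℕ-cancel-< (*<* p) = ℤ.drop‿+<+ (ℤ.*-cancelʳ-<-nonNeg (+ 1) p)

  fromℕ≤q⇒≤∣↥q∣ : ∀ h q → fromℕ h ℚᵘ.≤ q → h ℕ.≤ ℤ.∣ ℚᵘ.↥ q ∣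
  fromℕ≤q⇒≤∣↥q∣ h (mkℚᵘ n d) (*≤* p) = bound n (subst (+ h ℤ.* + suc d ℤ.≤_) (ℤ.*-identityʳ n) p)
    where
    bound : ∀ n → + h ℤ.* + suc d ℤ.≤ n → h ℕ.≤ ℤ.∣ n ∣
    bound (+ n) p = ℕ.≤-trans (ℕ.m≤m*n h (suc d))
      (ℤ.drop‿+≤+ (subst (ℤ._≤ + n) (sym (ℤ.pos-* h (suc d))) p))
    bound -[1+ n ] p
      with () ← subst (ℤ._≤ -[1+ n ]) (sym (ℤ.pos-* h (suc d))) p

<sup⇒< : ∀ {q P s} → IsSupremum P s → q <sup P → q <∞ s
<sup⇒< {s = ⊤⁺}    _          _              = tt
<sup⇒< {s = [ m ]} (upper , _) (h , Ph , q<h) with upper h Ph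
... | [ h≤m ] = ℚᵘ.<-≤-trans q<h (fromℕ-mono-≤ h≤m)

<⇒<sup : ∀ {q P s} → IsSupremum P s → ∃ P → q <∞ s → ¬ ¬ (q <sup P)
<⇒<sup {q} {P} {⊤⁺} (_ , least) _ _ none
  with () ← least [ ℤ.∣ ℚᵘ.↥ q ∣ ]
    (λ h Ph → [ fromℕ≤q⇒≤∣↥q∣ h q (ℚᵘ.≮⇒≥ (λ q<h → none (h , Ph , q<h))) ])
<⇒<sup {q} {P} {[ m ]} (_ , least) (h₀ , Ph₀) q<m none = contra m below least
  where
  below : ∀ h → P h → h ℕ.< m
  below h Ph = fromℕ-cancel-<
    (ℚᵘ.≤-<-trans (ℚᵘ.≮⇒≥ (λ q<h → none (h , Ph , q<h))) q<m)

  contra : ∀ m → (∀ h → P h → h ℕ.< m) →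
           ¬ (∀ t → (∀ h → P h → [ h ] ≤⁺ t) → [ m ] ≤⁺ t)
  contra zero    below _ with () ← below h₀ Ph₀
  contra (suc m) below least
    with least [ m ] (λ h Ph → [ ℕ.s≤s⁻¹ (below h Ph) ])
  ... | [ m<m ] = ℕ.<-irrefl _≡_.refl m<m

-- The natural subtraction n ∸ 1 is used only for n ≥ 1.
Ψ : ℕ → ℕ → ℚᵘ
Ψ n l =
  ((+ l ℤ.- + (2 ℕ.^ (n ℕ.∸ 1))) ℤ.* (+ n ℤ.- + 2) ℤ.* (+ n ℤ.- + 3)) ℚᵘ./ 2

{-# OPTIONS --safe #-}
-- For t = 0, 1, … take the complete graph on the letters t + 2^γ, γ < r = n − 2, and
-- write the edges {a, b} as blocks (ab)^(2n+1), ordered by t and then colexicographically.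
-- Differences of distinct powers of 2 are distinct, so all edges are different.
-- Suppose periods z₁ > z₂ > ⋯ occur from left to right. Then t weakly increases and the
-- first letter t + 2^γ of the period weakly decreases, so γ weakly decreases. It cannot
-- stay constant, for then t and the first letter would too, while the order of the blocks
-- makes the second letter weakly increase. Hence such a chain has at most r < n members.
-- If n ≤ 3 or l < 2^(n−1), then Ψ n l ≤ 0, and a single block (ab)^(2n+1) is enough: it is
-- too short to be strongly n-divisible.
module Submission where

open import Data.Fin as Fin using (Fin; zero; suc; toℕ; fromℕ<; Fin′)
import Data.Fin.Properties as Fin
open import Data.Integer as ℤ using (-[1+_])
import Data.Integer.Properties as ℤ
open import Data.List using (List; []; _∷_; _++_; concat; concatMap; length;
  lookup; map; replicate; tabulate)
open import Data.List.Properties using (++-assoc; ++-identityʳ; concatMap-++;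
  length-++; length-map; length-tabulate; map-replicate;
  ∷-injectiveˡ; ∷-injectiveʳ)
open import Data.List.Membership.Propositional using (_∈_)
open import Data.List.Membership.Propositional.Properties using (∈-lookup)
open import Data.List.Relation.Binary.Lex.Strict using (Lex-<; base; this; next)
open import Data.List.Relation.Binary.Prefix.Heterogeneous using ([]; _∷_)
open import Data.List.Relation.Unary.All as All using (All; []; _∷_)
import Data.List.Relation.Unary.All.Properties as All
open import Data.List.Relation.Unary.AllPairs as AllPairs using (AllPairs; []; _∷_)
import Data.List.Relation.Unary.AllPairs.Properties as AllPairs
open import Data.List.Relation.Unary.Any as Any using ()
open import Data.List.Relation.Unary.Any.Properties using (lookup-index)
open import Data.Nat using (ℕ; zero; suc; _+_; _*_; _^_; _∸_; _≤_; _<_; _≤?_; z≤n; s≤s; s≤s⁻¹)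
open import Data.Nat.Properties
open import Data.Nat.Tactic.RingSolver using (solve-∀)
open import Data.Product using (∃; ∃₂; Σ-syntax; _×_; _,_; proj₁; proj₂)
open import Data.Rational.Unnormalised as ℚᵘ using (*<*)
open import Data.Sum using (_⊎_; inj₁; inj₂)
open import Data.Unit using (⊤; tt)
open import Function using (_∘_)
open import Function.Definitions using (Injective)
open import Relation.Binary.Construct.Closure.Reflexive using (ReflClosure; refl; [_])
open import Relation.Binary.Definitions using (tri<; tri≈; tri>)
open import Relation.Binary.PropositionalEquality
  using (_≡_; _≢_; refl; sym; trans; cong; cong₂; subst; subst₂; module ≡-Reasoning)
open import Relation.Nullary using (¬_; yes; no; contradiction)
open import Defs

private variable
  A : Set
  l n : ℕ
  R : A → A → Set

-- Lists

lookup-mono : {xs : List A} → AllPairs R xs →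
  ∀ {i j : Fin (length xs)} → i Fin.< j → R (lookup xs i) (lookup xs j)
lookup-mono (px ∷ _)  {zero}  {suc j} _   = All.lookup px (∈-lookup j)
lookup-mono (_ ∷ pxs) {suc i} {suc j} i<j = lookup-mono pxs (s≤s⁻¹ i<j)

lookup-mono-≤ : {xs : List A} → AllPairs (ReflClosure R) xs →
  ∀ {i j : Fin (length xs)} → i Fin.≤ j → ReflClosure R (lookup xs i) (lookup xs j)
lookup-mono-≤ ps {i} {j} i≤j with i Fin.≟ j
... | yes refl = refl
... | no  i≢j  = lookup-mono ps (≤∧≢⇒< i≤j (i≢j ∘ Fin.toℕ-injective))

concat-tabulate⁺ : {f : Fin n → List A} → (∀ i → AllPairs R (f i)) →
  (∀ {i j} → i Fin.< j → All (λ x → All (R x) (f j)) (f i)) →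
  AllPairs R (concat (tabulate f))
concat-tabulate⁺ inner outer =
  AllPairs.concat⁺ (All.tabulate⁺ inner) (AllPairs.tabulate⁺-< outer)

blowUp : ℕ → List A → List A
blowUp m = concatMap (replicate m)

∈-blowUp⁻ : ∀ m (xs : List A) {y} → y ∈ blowUp m xs → y ∈ xs
∈-blowUp⁻ m xs = All.lookup
  (All.concat⁺ (All.map⁺ {P = All (_∈ xs)} {xs = xs} (All.tabulate (All.replicate⁺ m))))

replicate-reflexive : ∀ m (x : A) → AllPairs (ReflClosure R) (replicate m x)
replicate-reflexive zero    x = []
replicate-reflexive (suc m) x = All.replicate⁺ m refl ∷ replicate-reflexive m x

-- Copies of one element are related by reflexivity only, so a strict order on `xs` survives just as
-- its reflexive closure.
blowUp⁺ : ∀ m {xs : List A} → AllPairs R xs → AllPairs (ReflClosure R) (blowUp m xs)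
blowUp⁺ m {xs} ps = AllPairs.concat⁺
  (All.map⁺ (All.universal (replicate-reflexive m) xs))
  (AllPairs.map⁺ (AllPairs.map
    (λ r → All.replicate⁺ m (All.replicate⁺ m [ r ])) ps))

before : (Fin n → List A) → Fin n → List A
before f zero    = []
before f (suc i) = f zero ++ before (f ∘ suc) i

concat-tabulate-split : ∀ (f : Fin n → List A) i →
  ∃ λ s → concat (tabulate f) ≡ before f i ++ f i ++ s
concat-tabulate-split f zero    = _ , refl
concat-tabulate-split f (suc i) with s , eq ← concat-tabulate-split (f ∘ suc) i =
  s , trans (cong (f zero ++_) eq) (sym (++-assoc (f zero) _ _))

length-before : ∀ (f : Fin n → List A) {i j} → i Fin.< j →
  length (before f i) + length (f i) ≤ length (before f j)
length-before f {zero}  {suc j} _   =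
  subst (length (f zero) ≤_) (sym (length-++ (f zero))) (m≤m+n _ _)
length-before f {suc i} {suc j} i<j = begin
  length (f zero ++ before (f ∘ suc) i) + length (f (suc i))
    ≡⟨ cong (_+ length (f (suc i))) (length-++ (f zero)) ⟩
  length (f zero) + length (before (f ∘ suc) i) + length (f (suc i))
    ≡⟨ +-assoc (length (f zero)) _ _ ⟩
  length (f zero) + (length (before (f ∘ suc) i) + length (f (suc i)))
    ≤⟨ +-monoʳ-≤ (length (f zero)) (length-before (f ∘ suc) (s≤s⁻¹ i<j)) ⟩
  length (f zero) + length (before (f ∘ suc) j)
    ≡⟨ length-++ (f zero) ⟨
  length (f zero ++ before (f ∘ suc) j) ∎
  where open ≤-Reasoning

-- Words

⊑⇒++ : {u v : Word l} → u ⊑ v → ∃ λ s → v ≡ u ++ s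
⊑⇒++ []         = _ , refl
⊑⇒++ (refl ∷ p) with s , refl ← ⊑⇒++ p = s , refl

length-^ʷ : ∀ (v : Word l) k → length (v ^ʷ k) ≡ k * length v
length-^ʷ v zero    = refl
length-^ʷ v (suc k) = trans (length-++ v) (cong (_+_ (length v)) (length-^ʷ v k))

-- Distinct words of equal length differ at a position inside both, and the first such position
-- already decides the order of all their extensions.
lex-++⁻ : ∀ (u v : Word l) {s t} → length u ≡ length v → u ≢ v →
  Lex-< _≡_ Fin._<_ (u ++ s) (v ++ t) → Lex-< _≡_ Fin._<_ u v
lex-++⁻ []      []      _  u≢v _             = contradiction refl u≢v
lex-++⁻ (a ∷ u) (b ∷ v) _  _   (this a<b)    = this a<b
lex-++⁻ (a ∷ u) (b ∷ v) eq u≢v (next refl p) =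
  next refl (lex-++⁻ u v (suc-injective eq) (u≢v ∘ cong (a ∷_)) p)

-- A power of length 2 with exponent above 1 is the square of a single letter, so its two letters
-- agree.
nonCyclic-pair : {a b : Fin l} → a ≢ b → NonCyclicOfLength 2 (a ∷ b ∷ [])
nonCyclic-pair {l} {a} {b} a≢b = notPower , refl
  where
  []^ʷ : ∀ k → [] {A = Fin l} ^ʷ k ≡ []
  []^ʷ zero    = refl
  []^ʷ (suc k) = []^ʷ k

  notPower : NonCyclic (a ∷ b ∷ [])
  notPower ([] , k , _ , eq) with () ← trans eq ([]^ʷ k)
  notPower (_ ∷ _ , suc zero , s≤s () , _)
  notPower (c ∷ [] , suc (suc k) , _ , eq) =
    a≢b (trans (∷-injectiveˡ eq) (sym (∷-injectiveˡ (∷-injectiveʳ eq))))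
  notPower (c ∷ d ∷ [] , suc (suc k) , _ , ())
  notPower (c ∷ d ∷ e ∷ v , suc (suc k) , _ , ())

cyclicShift-pair⁻ : {a b c d : Fin l} → CyclicShift (a ∷ b ∷ []) (c ∷ d ∷ []) →
  (a ≡ c × b ≡ d) ⊎ (a ≡ d × b ≡ c)
cyclicShift-pair⁻ ([]         , _      , refl , refl) = inj₁ (refl , refl)
cyclicShift-pair⁻ (_ ∷ []     , _ ∷ [] , refl , refl) = inj₂ (refl , refl)
cyclicShift-pair⁻ (_ ∷ _ ∷ [] , []     , refl , refl) = inj₁ (refl , refl)

begins-length : ∀ {k Z} {W : Word l} → (∀ {z} → Z z → length z ≡ 2) →
  (S : StronglyDivisible Z k n W) → ∀ i → k * 2 ≤ length (StronglyDivisible.part S i)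
begins-length {k = k} len S i with s , eq ← ⊑⇒++ (StronglyDivisible.begins S i) = begin
  k * 2                       ≡⟨ cong (k *_) (len (period∈Z i)) ⟨
  k * length (period i)       ≡⟨ length-^ʷ (period i) k ⟨
  length (period i ^ʷ k)      ≤⟨ m≤m+n _ _ ⟩
  length (period i ^ʷ k) + length s ≡⟨ length-++ (period i ^ʷ k) ⟨
  length (period i ^ʷ k ++ s) ≡⟨ cong length eq ⟨
  length (part i)             ∎
  where
  open StronglyDivisible S
  open ≤-Reasoning

-- There are at least two parts, and each begins with a power of 2k letters.
stronglyDivisible-length : ∀ {k Z} {W : Word l} → (∀ {z} → Z z → length z ≡ 2) →
  StronglyDivisible Z k (2 + n) W → k * 4 ≤ length W
stronglyDivisible-length {k = k} {W = W} len S
  with s , eq ← concat-tabulate-split (StronglyDivisible.part S) (suc zero) = begin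
  k * 4                                         ≡⟨ *-distribˡ-+ k 2 2 ⟩
  k * 2 + k * 2
    ≤⟨ +-mono-≤ (begins-length len S zero) (begins-length len S (suc zero)) ⟩
  length (part zero) + length (part (suc zero))
    ≤⟨ +-mono-≤ (length-before part {zero} {suc zero} (s≤s z≤n)) (m≤m+n _ (length s)) ⟩
  length (before part (suc zero)) + (length (part (suc zero)) + length s)
    ≡⟨ cong (length (before part (suc zero)) +_) (length-++ (part (suc zero))) ⟨
  length (before part (suc zero)) + length (part (suc zero) ++ s)
    ≡⟨ length-++ (before part (suc zero)) ⟨
  length (before part (suc zero) ++ part (suc zero) ++ s) ≡⟨ cong length eq ⟨
  length (concat (tabulate part))               ≤⟨ m≤n+m _ (length head) ⟩
  length head + length (concat (tabulate part)) ≡⟨ length-++ head ⟨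
  length (head ++ concat (tabulate part))       ≡⟨ cong length factorization ⟨
  length W                                      ∎
  where
  open StronglyDivisible S
  open ≤-Reasoning

-- Words spelled by a sequence of ordered pairs of letters

module Spelling {X : Set} (lo hi : X → Fin l) where

  word : X → Word l
  word e = lo e ∷ hi e ∷ []

  spell : List X → Word l
  spell = concatMap word

  -- A power of a two-letter period may start in the middle of an aligned pair. The period is then a
  -- pair reversed, which is still in the cyclic class of that pair.
  data Reads (e : X) : Word l → Set where
    forward  : Reads e (lo e ∷ hi e ∷ [])
    backward : Reads e (hi e ∷ lo e ∷ [])

  reads-cyclicShift : ∀ {e z z′} → Reads e z → Reads e z′ → CyclicShift z z′
  reads-cyclicShift forward  forward  = [] , _ , refl , sym (++-identityʳ _)
  reads-cyclicShift forward  backward = _ ∷ [] , _ ∷ [] , refl , refl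
  reads-cyclicShift backward forward  = _ ∷ [] , _ ∷ [] , refl , refl
  reads-cyclicShift backward backward = [] , _ , refl , sym (++-identityʳ _)

  -- A factor xyx starting at position |u| covers the aligned pair xy if |u| is even and
  -- the aligned pair yx if |u| is odd.
  occurrence : ∀ P u {x y s} → spell P ≡ u ++ x ∷ y ∷ x ∷ s →
    ∃ λ (q : Fin (length P)) → length u ≤ toℕ q * 2 × toℕ q * 2 ≤ suc (length u) ×
      Reads (lookup P q) (x ∷ y ∷ [])
  occurrence []      []          ()
  occurrence []      (_ ∷ _)     ()
  occurrence (e ∷ P) [] eq
    with refl ← ∷-injectiveˡ eq | refl ← ∷-injectiveˡ (∷-injectiveʳ eq)
    = zero , z≤n , z≤n , forward
  occurrence (e ∷ [])    (c ∷ []) eq with () ← ∷-injectiveʳ (∷-injectiveʳ eq)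
  occurrence (e ∷ f ∷ P) (c ∷ []) eq
    with eq′ ← ∷-injectiveʳ (∷-injectiveʳ eq)
    with refl ← ∷-injectiveˡ eq′ | refl ← ∷-injectiveˡ (∷-injectiveʳ eq′)
    = suc zero , s≤s z≤n , s≤s (s≤s z≤n) , backward
  occurrence (e ∷ P) (c ∷ d ∷ u) eq
    with q , u≤q , q≤u , ρ ← occurrence P u (∷-injectiveʳ (∷-injectiveʳ eq))
    = suc q , s≤s (s≤s u≤q) , s≤s (s≤s q≤u) , ρ

  -- With exponent at least 2 the power begins with xyx, three letters that cover a whole aligned
  -- pair whatever the parity of the offset.
  power-occurrence : ∀ P u {z k s} → length z ≡ 2 → 2 ≤ k → spell P ≡ u ++ z ^ʷ k ++ s →
    ∃ λ (q : Fin (length P)) → length u ≤ toℕ q * 2 × toℕ q * 2 ≤ suc (length u) ×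
      Reads (lookup P q) z
  power-occurrence P u {x ∷ y ∷ []} {suc (suc k)} _ _ eq = occurrence P u eq
  power-occurrence P u {x ∷ y ∷ []} {suc zero} _ (s≤s ()) _

  spell-replicate : ∀ m e → spell (replicate m e) ≡ word e ^ʷ m
  spell-replicate m e = cong concat (map-replicate word m e)

  spell-blowUp : ∀ m E →
    spell (blowUp m E) ≡ concat (tabulate λ i → word (lookup E i) ^ʷ m)
  spell-blowUp m []      = refl
  spell-blowUp m (e ∷ E) = begin
    spell (replicate m e ++ blowUp m E)
      ≡⟨ concatMap-++ word (replicate m e) (blowUp m E) ⟩
    spell (replicate m e) ++ spell (blowUp m E)
      ≡⟨ cong₂ _++_ (spell-replicate m e) (spell-blowUp m E) ⟩
    word e ^ʷ m ++ concat (tabulate λ i → word (lookup E i) ^ʷ m) ∎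
    where open ≡-Reasoning

  -- Every entry of `E` contributes its own block, with the least allowed exponent k + 1.
  -- Conversely, every selected power reads some entry of `E`, and two powers reading the same entry
  -- would have cyclically equivalent periods, so no more than `length E` can be selected.
  smallSelectiveHeight : ∀ {k} E → 2 ≤ k → (∀ e → lo e ≢ hi e) →
    (∀ {i j} → i ≢ j → ¬ CyclicShift (word (lookup E i)) (word (lookup E j))) →
    IsSmallSelectiveHeight (NonCyclicOfLength 2) k (spell (blowUp (suc k) E)) (length E)
  smallSelectiveHeight {k} E 2≤k lo≢hi E-inequivalent = selection , bound
    where
    P = blowUp (suc k) E

    selection : Selection (NonCyclicOfLength 2) k (spell P) (length E)
    selection = record
      { gap           = λ _ → []
      ; period        = word ∘ lookup E
      ; exponent      = λ _ → suc k
      ; tail          = []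
      ; factorization = trans (spell-blowUp (suc k) E) (sym (++-identityʳ _))
      ; period∈Z      = λ i → nonCyclic-pair (lo≢hi (lookup E i))
      ; large         = λ _ → ≤-refl
      ; inequivalent  = E-inequivalent
      }

    bound : ∀ h → Selection (NonCyclicOfLength 2) k (spell P) h → h ≤ length E
    bound h S = Fin.injective⇒≤ {f = index} index-injective
      where
      open Selection S

      powers : Fin h → Word l
      powers i = gap i ++ period i ^ʷ exponent i

      occurs : ∀ i → ∃₂ λ u s → spell P ≡ u ++ period i ^ʷ exponent i ++ s
      occurs i with s , eq ← concat-tabulate-split powers i =
        before powers i ++ gap i , s ++ tail , (begin
          spell P ≡⟨ factorization ⟩
          concat (tabulate powers) ++ tail ≡⟨ cong (_++ tail) eq ⟩
          (u ++ (gap i ++ z) ++ s) ++ tail ≡⟨ ++-assoc u _ tail ⟩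
          u ++ ((gap i ++ z) ++ s) ++ tail ≡⟨ cong (u ++_) (++-assoc (gap i ++ z) s tail) ⟩
          u ++ (gap i ++ z) ++ s ++ tail   ≡⟨ cong (u ++_) (++-assoc (gap i) z (s ++ tail)) ⟩
          u ++ gap i ++ z ++ s ++ tail     ≡⟨ ++-assoc u (gap i) _ ⟨
          (u ++ gap i) ++ z ++ s ++ tail   ∎)
        where
        open ≡-Reasoning
        u = before powers i
        z = period i ^ʷ exponent i

      position : ∀ i → ∃ λ (κ : Fin (length E)) → Reads (lookup E κ) (period i)
      position i
        with u , s , eq ← occurs i
        with q , _ , _ , ρ ← power-occurrence P u (proj₂ (period∈Z i))
                               (≤-trans 2≤k (<⇒≤ (large i))) eq
        -- Positions in `P` are too numerous for the bound, so the copy that was read is traced back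
        -- to the entry of `E` it repeats.
        with e∈E ← ∈-blowUp⁻ (suc k) E (∈-lookup {xs = P} q)
        = Any.index e∈E , subst (λ e → Reads e (period i)) (lookup-index e∈E) ρ

      index : Fin h → Fin (length E)
      index i = proj₁ (position i)

      index-injective : Injective _≡_ _≡_ index
      index-injective {i} {j} eq with i Fin.≟ j
      ... | yes i≡j = i≡j
      ... | no  i≢j = contradiction
        (reads-cyclicShift (proj₂ (position i))
          (subst (λ κ → Reads (lookup E κ) (period j)) (sym eq) (proj₂ (position j))))
        (inequivalent i≢j)

  -- Every part starts with a power, so a pair of `P` is read at its start. These pairs follow the
  -- order of the parts from left to right, while the lexicographic order of the parts is already
  -- decided by their periods, which are distinct and equally long.
  stronglyDivisible-chain : ∀ {k n} P → 2 ≤ k →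
    StronglyDivisible (NonCyclicOfLength 2) k n (spell P) →
    ∃₂ λ (z : Fin n → Word l) (q : Fin n → Fin (length P)) →
      (∀ i → Reads (lookup P (q i)) (z i)) ×
      (∀ {i j} → i Fin.< j → q i Fin.≤ q j × Lex-< _≡_ Fin._<_ (z j) (z i))
  stronglyDivisible-chain {k} {n} P 2≤k S =
    period , position , (λ i → proj₂ (proj₂ (proj₂ (found i)))) ,
    (λ i<j → position-mono i<j , period-anti i<j)
    where
    open StronglyDivisible S

    offset : Fin n → Word l
    offset i = head ++ before part i

    occurs : ∀ i → ∃ λ s → spell P ≡ offset i ++ period i ^ʷ k ++ s
    occurs i
      with s , eq ← concat-tabulate-split part i | t , eq′ ← ⊑⇒++ (begins i)
      = t ++ s , (begin
        spell P ≡⟨ factorization ⟩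
        head ++ concat (tabulate part) ≡⟨ cong (head ++_) eq ⟩
        head ++ before part i ++ part i ++ s ≡⟨ ++-assoc head _ _ ⟨
        offset i ++ part i ++ s ≡⟨ cong (λ w → offset i ++ w ++ s) eq′ ⟩
        offset i ++ (period i ^ʷ k ++ t) ++ s
          ≡⟨ cong (offset i ++_) (++-assoc (period i ^ʷ k) t s) ⟩
        offset i ++ period i ^ʷ k ++ t ++ s ∎)
      where open ≡-Reasoning

    found : ∀ i → ∃ λ (q : Fin (length P)) →
      length (offset i) ≤ toℕ q * 2 × toℕ q * 2 ≤ suc (length (offset i)) ×
      Reads (lookup P q) (period i)
    found i = power-occurrence P (offset i) (proj₂ (period∈Z i)) 2≤k (proj₂ (occurs i))

    position : Fin n → Fin (length P)
    position i = proj₁ (found i)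

    position-mono : ∀ {i j} → i Fin.< j → position i Fin.≤ position j
    -- The pair that is read may start one letter after its part does. Since part `i` is nonempty,
    -- part `j` starts late enough to absorb this rounding.
    position-mono {i} {j} i<j = *-cancelʳ-≤ _ _ 2 (begin
      toℕ (position i) * 2 ≤⟨ proj₁ (proj₂ (proj₂ (found i))) ⟩
      suc (length (offset i)) ≡⟨ cong suc (length-++ head) ⟩
      suc (length head + length (before part i)) ≡⟨ +-comm 1 _ ⟩
      length head + length (before part i) + 1 ≡⟨ +-assoc (length head) _ 1 ⟩
      length head + (length (before part i) + 1)
        ≤⟨ +-monoʳ-≤ (length head) (+-monoʳ-≤ (length (before part i)) 1≤part) ⟩
      length head + (length (before part i) + length (part i))
        ≤⟨ +-monoʳ-≤ (length head) (length-before part i<j) ⟩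
      length head + length (before part j) ≡⟨ length-++ head ⟨
      length (offset j) ≤⟨ proj₁ (proj₂ (found j)) ⟩
      toℕ (position j) * 2 ∎)
      where
      open ≤-Reasoning
      1≤part : 1 ≤ length (part i)
      1≤part = ≤-trans (≤-trans (<⇒≤ 2≤k) (m≤m*n k 2)) (begins-length proj₂ S i)

    period-anti : ∀ {i j} → i Fin.< j → Lex-< _≡_ Fin._<_ (period j) (period i)
    period-anti {i} {j} i<j = lex-++⁻ (period j) (period i)
      (trans (proj₂ (period∈Z j)) (sym (proj₂ (period∈Z i))))
      (λ eq → <⇒≢ i<j (cong toℕ (sym (distinct eq))))
      (subst₂ (Lex-< _≡_ Fin._<_) (proj₂ (first j)) (proj₂ (first i))
        (proj₂ (decreasing i<j)))
      where
      first : ∀ i → ∃ λ s → part i ≡ period i ++ s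
      first i with s , eq ← ⊑⇒++ (begins i) = power-first (period i) 2≤k s eq
        where
        power-first : ∀ z {k} → 2 ≤ k → ∀ s {w} → w ≡ z ^ʷ k ++ s → ∃ λ s → w ≡ z ++ s
        power-first z {suc k} _ s eq = z ^ʷ k ++ s , trans eq (++-assoc z (z ^ʷ k) s)

  -- A strong n-division would yield n periods with strictly decreasing ranks, hence an injection of
  -- `Fin n` into `Fin r`, impossible for r < n.
  notStronglyDivisible : ∀ {k n r} (P : List X) {R : X → X → Set} → 2 ≤ k → r < n →
    AllPairs (ReflClosure R) P → (rank : ∀ {e z} → Reads e z → Fin r) →
    (∀ {e e′ z z′} → ReflClosure R e e′ → (ρ : Reads e z) (ρ′ : Reads e′ z′) →
      Lex-< _≡_ Fin._<_ z′ z → rank ρ′ Fin.< rank ρ) →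
    ¬ StronglyDivisible (NonCyclicOfLength 2) k n (spell P)
  notStronglyDivisible {n = n} {r = r} P 2≤k r<n sorted rank descends S
    with z , q , ρ , decreasing ← stronglyDivisible-chain P 2≤k S
    = <⇒≱ r<n (Fin.injective⇒≤ {f = rank ∘ ρ} injective)
    where
    rank-anti : ∀ {i j} → i Fin.< j → rank (ρ j) Fin.< rank (ρ i)
    rank-anti {i} {j} i<j = descends (lookup-mono-≤ sorted (proj₁ (decreasing i<j)))
      (ρ i) (ρ j) (proj₂ (decreasing i<j))

    injective : Injective _≡_ _≡_ (rank ∘ ρ)
    injective {i} {j} eq with Fin.<-cmp i j
    ... | tri< i<j _ _ = contradiction (cong toℕ (sym eq)) (<⇒≢ (rank-anti i<j))
    ... | tri≈ _ i≡j _ = i≡j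
    ... | tri> _ _ j<i = contradiction (cong toℕ eq) (<⇒≢ (rank-anti j<i))

-- Powers of 2

2^-cancel-≤ : ∀ {a b} → 2 ^ a ≤ 2 ^ b → a ≤ b
2^-cancel-≤ p = ≮⇒≥ (λ b<a → <⇒≱ (^-monoʳ-< 2 ≤-refl b<a) p)

2^-cancel-< : ∀ a b → 2 ^ a < 2 ^ b → a < b
2^-cancel-< a b p = ≰⇒> (λ b≤a → <⇒≱ p (^-monoʳ-≤ 2 b≤a))

2^-injective : ∀ {a b} → 2 ^ a ≡ 2 ^ b → a ≡ b
2^-injective eq =
  ≤-antisym (2^-cancel-≤ (≤-reflexive eq)) (2^-cancel-≤ (≤-reflexive (sym eq)))

-- Each summand is at most half of 2^c.
2^-sum-≤ : ∀ {a b c} → a < c → b < c → 2 ^ a + 2 ^ b ≤ 2 ^ c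
2^-sum-≤ {c = suc c} a<c b<c = +-mono-≤ (^-monoʳ-≤ 2 (s≤s⁻¹ a<c))
  (≤-trans (^-monoʳ-≤ 2 (s≤s⁻¹ b<c)) (≤-reflexive (sym (+-identityʳ _))))

-- Eliminating `t` and `t′` gives 2^b + 2^a′ = 2^b′ + 2^a. If b < b′, both exponents on the left lie
-- below b′, so the left side is at most 2^b′ and the equation fails.
2^-difference-≤ : ∀ t t′ a {b} a′ {b′} → a′ < b′ →
  t + 2 ^ a ≡ t′ + 2 ^ a′ → t + 2 ^ b ≡ t′ + 2 ^ b′ → b′ ≤ b
2^-difference-≤ t t′ a {b} a′ {b′} a′<b′ eqₐ eq_b = ≮⇒≥ (λ b<b′ → <⇒≱
  (m<m+n (2 ^ b′) (m^n>0 2 a))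
  (≤-trans (≤-reflexive (sym sums)) (2^-sum-≤ b<b′ a′<b′)))
  where
  open ≡-Reasoning
  rearrange : ∀ t u x y → t + u + (x + y) ≡ (t + x) + (u + y)
  rearrange = solve-∀
  rearrange′ : ∀ t u x y → (u + x) + (t + y) ≡ t + u + (x + y)
  rearrange′ = solve-∀
  sums : 2 ^ b + 2 ^ a′ ≡ 2 ^ b′ + 2 ^ a
  sums = +-cancelˡ-≡ (t + t′) _ _ (begin
    t + t′ + (2 ^ b + 2 ^ a′)     ≡⟨ rearrange t t′ (2 ^ b) (2 ^ a′) ⟩
    (t + 2 ^ b) + (t′ + 2 ^ a′)   ≡⟨ cong₂ _+_ eq_b (sym eqₐ) ⟩
    (t′ + 2 ^ b′) + (t + 2 ^ a)   ≡⟨ rearrange′ t t′ (2 ^ b′) (2 ^ a) ⟩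
    t + t′ + (2 ^ b′ + 2 ^ a)     ∎)

-- The previous bound, used in both directions, gives b = b′; cancelling then yields t = t′ and
-- finally a = a′.
2^-difference-injective : ∀ t t′ {a b a′ b′} → a < b → a′ < b′ →
  t + 2 ^ a ≡ t′ + 2 ^ a′ → t + 2 ^ b ≡ t′ + 2 ^ b′ → t ≡ t′ × a ≡ a′ × b ≡ b′
2^-difference-injective t t′ {a} {b} {a′} {b′} a<b a′<b′ eqₐ eq_b
  with refl ← ≤-antisym (2^-difference-≤ t′ t a′ a a<b (sym eqₐ) (sym eq_b))
                        (2^-difference-≤ t t′ a a′ a′<b′ eqₐ eq_b)
  with refl ← +-cancelʳ-≡ (2 ^ b) t t′ eq_b
  = refl , 2^-injective (+-cancelˡ-≡ t _ _ eqₐ) , refl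

-- The edges of the complete graphs on the letters t + 2^γ

module Cliques (T r : ℕ) (fits : T + 2 ^ r ≤ l) where

  -- `Fin′ j` consists of the numbers below `j`, so every edge of a clique occurs in one orientation
  -- only, the smaller exponent being the `Fin′ j` component.
  Edge : Set
  Edge = Fin T × Σ[ j ∈ Fin r ] Fin′ j

  loExp hiExp : Edge → Fin r
  loExp (_ , _ , i) = Fin.inject i
  hiExp (_ , j , _) = j

  loExp<hiExp : ∀ e → loExp e Fin.< hiExp e
  loExp<hiExp (_ , j , i) = subst (_< toℕ j) (sym (Fin.toℕ-inject i)) (Fin.toℕ<n i)

  letter-fits : (t : Fin T) (γ : Fin r) → toℕ t + 2 ^ toℕ γ < l
  letter-fits t γ =
    ≤-trans (+-mono-≤ (Fin.toℕ<n t) (^-monoʳ-≤ 2 (<⇒≤ (Fin.toℕ<n γ)))) fits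

  -- Abstract, so that t and γ can be inferred from letter t γ.
  abstract
    letter : Fin T → Fin r → Fin l
    letter t γ = fromℕ< (letter-fits t γ)

    toℕ-letter : ∀ t γ → toℕ (letter t γ) ≡ toℕ t + 2 ^ toℕ γ
    toℕ-letter t γ = Fin.toℕ-fromℕ< (letter-fits t γ)

  letter-≡⁻ : ∀ {t t′ γ γ′} → letter t γ ≡ letter t′ γ′ →
    toℕ t + 2 ^ toℕ γ ≡ toℕ t′ + 2 ^ toℕ γ′
  letter-≡⁻ {t} {t′} {γ} {γ′} eq =
    trans (sym (toℕ-letter t γ)) (trans (cong toℕ eq) (toℕ-letter t′ γ′))

  letter-<⁻ : ∀ {t t′ γ γ′} → letter t γ Fin.< letter t′ γ′ →
    toℕ t + 2 ^ toℕ γ < toℕ t′ + 2 ^ toℕ γ′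
  letter-<⁻ {t} {t′} {γ} {γ′} = subst₂ _<_ (toℕ-letter t γ) (toℕ-letter t′ γ′)

  lo hi : Edge → Fin l
  lo e = letter (proj₁ e) (loExp e)
  hi e = letter (proj₁ e) (hiExp e)

  open Spelling lo hi

  lo<hi : ∀ e → toℕ (proj₁ e) + 2 ^ toℕ (loExp e) < toℕ (proj₁ e) + 2 ^ toℕ (hiExp e)
  lo<hi e = +-monoʳ-< (toℕ (proj₁ e)) (^-monoʳ-< 2 ≤-refl (loExp<hiExp e))

  lo≢hi : ∀ e → lo e ≢ hi e
  lo≢hi e eq = <⇒≢ (lo<hi e) (letter-≡⁻ eq)

  -- A word of an edge has its smaller letter first, so two such words cannot be reversals of each
  -- other. If they agree letter by letter, the difference of the letters determines the exponents
  -- and then the shift.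
  word-injective : ∀ e e′ → CyclicShift (word e) (word e′) → e ≡ e′
  word-injective e@(t , j , i) e′@(t′ , j′ , i′) shift with cyclicShift-pair⁻ shift
  ... | inj₂ (p , q) = contradiction
    (<-trans (lo<hi e) (subst (_< toℕ t + 2 ^ toℕ (loExp e)) (sym (letter-≡⁻ q))
      (subst (toℕ t′ + 2 ^ toℕ (loExp e′) <_) (sym (letter-≡⁻ p)) (lo<hi e′))))
    (<-irrefl refl)
  ... | inj₁ (p , q)
    with t≡ , i≡ , j≡ ← 2^-difference-injective (toℕ t) (toℕ t′)
           (loExp<hiExp e) (loExp<hiExp e′) (letter-≡⁻ p) (letter-≡⁻ q)
    with refl ← Fin.toℕ-injective t≡ | refl ← Fin.toℕ-injective j≡
    with refl ← Fin.toℕ-injective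
           (trans (sym (Fin.toℕ-inject i)) (trans i≡ (Fin.toℕ-inject i′)))
    = refl

  infix 4 _⊏_

  -- Within one clique the larger exponent is compared first: along the word `hiExp` never falls,
  -- and `loExp` falls only where `hiExp` rises.
  _⊏_ : Edge → Edge → Set
  (t , j , i) ⊏ (t′ , j′ , i′) =
    t Fin.< t′ ⊎ (t ≡ t′ × (j Fin.< j′ ⊎ (j ≡ j′ × toℕ i < toℕ i′)))

  ⊏-irrefl : ∀ {e} → ¬ e ⊏ e
  ⊏-irrefl (inj₁ t<t)                    = <-irrefl refl t<t
  ⊏-irrefl (inj₂ (_ , inj₁ j<j))         = <-irrefl refl j<j
  ⊏-irrefl (inj₂ (_ , inj₂ (_ , i<i)))   = <-irrefl refl i<i

  ⊏⁼-shift : ∀ {e e′} → ReflClosure _⊏_ e e′ → proj₁ e Fin.≤ proj₁ e′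
  ⊏⁼-shift refl                = ≤-refl
  ⊏⁼-shift [ inj₁ t<t′ ]       = <⇒≤ t<t′
  ⊏⁼-shift [ inj₂ (refl , _) ] = ≤-refl

  ⊏⁼-hiExp : ∀ {e e′} → ReflClosure _⊏_ e e′ → proj₁ e ≡ proj₁ e′ → hiExp e Fin.≤ hiExp e′
  ⊏⁼-hiExp refl                               _    = ≤-refl
  ⊏⁼-hiExp [ inj₁ t<t ]                       refl = contradiction t<t (<-irrefl refl)
  ⊏⁼-hiExp [ inj₂ (_ , inj₁ j<j′) ]           _    = <⇒≤ j<j′
  ⊏⁼-hiExp [ inj₂ (_ , inj₂ (refl , _)) ]     _    = ≤-refl

  ⊏⁼-loExp : ∀ {e e′} → ReflClosure _⊏_ e e′ → proj₁ e ≡ proj₁ e′ → hiExp e ≡ hiExp e′ →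
    loExp e Fin.≤ loExp e′
  ⊏⁼-loExp refl                             _    _    = ≤-refl
  ⊏⁼-loExp [ inj₁ t<t ]                     refl _    = contradiction t<t (<-irrefl refl)
  ⊏⁼-loExp [ inj₂ (_ , inj₁ j<j) ]          _    refl = contradiction j<j (<-irrefl refl)
  ⊏⁼-loExp {_ , _ , i} {_ , _ , i′} [ inj₂ (_ , inj₂ (_ , i<i′)) ] _ _ =
    subst₂ _≤_ (sym (Fin.toℕ-inject i)) (sym (Fin.toℕ-inject i′)) (<⇒≤ i<i′)

  pairs : List (Σ[ j ∈ Fin r ] Fin′ j)
  pairs = concat (tabulate λ j → tabulate (j ,_))

  edges : List Edge
  edges = concat (tabulate λ t → map (t ,_) pairs)

  edges-sorted : AllPairs _⊏_ edges
  edges-sorted = concat-tabulate⁺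
    (λ t → AllPairs.map⁺ (AllPairs.map (λ p → inj₂ (refl , p)) pairs-sorted))
    (λ t<t′ → All.map⁺ (All.universal (λ _ →
      All.map⁺ (All.universal (λ _ → inj₁ t<t′) pairs)) pairs))
    where
    pairs-sorted : AllPairs
      (λ (j , i) (j′ , i′) → j Fin.< j′ ⊎ (j ≡ j′ × toℕ i < toℕ i′)) pairs
    pairs-sorted = concat-tabulate⁺
      (λ j → AllPairs.tabulate⁺-< (λ i<i′ → inj₂ (refl , i<i′)))
      (λ j<j′ → All.tabulate⁺ (λ _ → All.tabulate⁺ (λ _ → inj₁ j<j′)))

  edges-inequivalent : ∀ {i j} → i ≢ j →
    ¬ CyclicShift (word (lookup edges i)) (word (lookup edges j))
  edges-inequivalent {i} {j} i≢j shift
    with eq ← word-injective (lookup edges i) (lookup edges j) shift | Fin.<-cmp i j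
  ... | tri< i<j _ _ = ⊏-irrefl (subst (_⊏ lookup edges j) eq (lookup-mono edges-sorted i<j))
  ... | tri≈ _ i≡j _ = i≢j i≡j
  ... | tri> _ _ j<i = ⊏-irrefl (subst (lookup edges j ⊏_) eq (lookup-mono edges-sorted j<i))

  -- Descent of exponents along a chain of periods

  -- This is the exponent of the first letter of the period, which depends on the direction of
  -- reading.
  rank : ∀ {e z} → Reads e z → Fin r
  rank {e} forward  = loExp e
  rank {e} backward = hiExp e

  -- If γ ≤ γ′, the first letter cannot drop, as the shift does not drop either. If the first
  -- letters are equal, a rise of the shift forces γ′ < γ, whereas equal shifts force γ′ = γ and
  -- leave the decision to the second letters.
  exponent-descends : ∀ {t t′ γ γ′ δ δ′} → t Fin.≤ t′ →
    Lex-< _≡_ Fin._<_ (letter t′ γ′ ∷ letter t′ δ′ ∷ []) (letter t γ ∷ letter t δ ∷ []) →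
    γ′ Fin.< γ ⊎ (t ≡ t′ × γ′ ≡ γ × δ′ Fin.< δ)
  exponent-descends {γ = γ} {γ′} t≤t′ (this v′<v) = inj₁ (≰⇒> (λ γ≤γ′ →
    <⇒≱ (letter-<⁻ v′<v) (+-mono-≤ t≤t′ (^-monoʳ-≤ 2 γ≤γ′))))
  exponent-descends {t} {t′} {γ} {γ′} {δ} {δ′} t≤t′ (next v′≡v w) with t Fin.≟ t′
  ... | no t≢t′ = inj₁ (≰⇒> (λ γ≤γ′ →
    <⇒≱ (+-mono-<-≤ (≤∧≢⇒< t≤t′ (t≢t′ ∘ Fin.toℕ-injective)) (^-monoʳ-≤ 2 γ≤γ′))
      (≤-reflexive (letter-≡⁻ v′≡v))))
  ... | yes refl with w
  ...   | this w′<w = inj₂ (refl ,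
    Fin.toℕ-injective (2^-injective (+-cancelˡ-≡ (toℕ t) _ _ (letter-≡⁻ v′≡v))) ,
    2^-cancel-< (toℕ δ′) (toℕ δ) (+-cancelˡ-< (toℕ t) _ _ (letter-<⁻ w′<w)))
  ...   | next _ (base ())

  -- A tie in `exponent-descends` keeps both edges in one clique. It would make `hiExp` fall there,
  -- or, when both are read backward, make `loExp` fall at constant `hiExp`; the order of the blocks
  -- excludes both.
  rank-descends : ∀ {e e′ z z′} → ReflClosure _⊏_ e e′ → (ρ : Reads e z) (ρ′ : Reads e′ z′) →
    Lex-< _≡_ Fin._<_ z′ z → rank ρ′ Fin.< rank ρ
  rank-descends {e} {e′} e⊏e′ forward forward z′<z
    with exponent-descends (⊏⁼-shift e⊏e′) z′<z
  ... | inj₁ p             = p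
  ... | inj₂ (t≡ , _ , j′<j) = contradiction (⊏⁼-hiExp e⊏e′ t≡) (<⇒≱ j′<j)
  rank-descends {e} {e′} e⊏e′ forward backward z′<z
    with exponent-descends (⊏⁼-shift e⊏e′) z′<z
  ... | inj₁ p             = p
  ... | inj₂ (t≡ , j′≡i , _) = contradiction (⊏⁼-hiExp e⊏e′ t≡)
    (<⇒≱ (subst (Fin._< hiExp e) (sym j′≡i) (loExp<hiExp e)))
  rank-descends {e} {e′} e⊏e′ backward forward z′<z
    with exponent-descends (⊏⁼-shift e⊏e′) z′<z
  ... | inj₁ p             = p
  ... | inj₂ (t≡ , _ , j′<i) = contradiction (⊏⁼-hiExp e⊏e′ t≡)
    (<⇒≱ (<-trans j′<i (loExp<hiExp e)))
  rank-descends {e} {e′} e⊏e′ backward backward z′<z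
    with exponent-descends (⊏⁼-shift e⊏e′) z′<z
  ... | inj₁ p             = p
  ... | inj₂ (t≡ , j′≡j , i′<i) =
    contradiction (⊏⁼-loExp e⊏e′ t≡ (sym j′≡j)) (<⇒≱ i′<i)

  edges-height : ∀ {k n} → 2 ≤ k → r < n →
    SmallSelectiveHeights (NonCyclicOfLength 2) k
      (λ W → ¬ StronglyDivisible (NonCyclicOfLength 2) k n W) (length edges)
  edges-height {k} 2≤k r<n = spell (blowUp (suc k) edges) ,
    notStronglyDivisible (blowUp (suc k) edges) 2≤k r<n
      (blowUp⁺ (suc k) edges-sorted) rank rank-descends ,
    smallSelectiveHeight edges 2≤k lo≢hi edges-inequivalent

  -- Number of edges

  -- This is the count r(r - 1)/2, stated without division or subtraction.
  length-pairs : length pairs * 2 + r ≡ r * r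
  length-pairs = triangular {n = r} (λ j → tabulate (j ,_)) 0
    (λ j → length-tabulate {n = toℕ j} (j ,_))
    where
    arithmetic : ∀ c n → (c + 0) * 2 + n * (suc c * 2 + n) + 1 ≡ suc n * (c * 2 + suc n)
    arithmetic = solve-∀

    rearrange : ∀ x y n → (x + y) * 2 + suc n ≡ x * 2 + (y * 2 + n) + 1
    rearrange = solve-∀

    -- The offset `c` is there for the induction: without the first row, the remaining rows start
    -- one element longer.
    triangular : ∀ {n} (f : Fin n → List A) c → (∀ i → length (f i) ≡ c + toℕ i) →
      length (concat (tabulate f)) * 2 + n ≡ n * (c * 2 + n)
    triangular {n = zero}  f c len = refl
    triangular {n = suc n} f c len = begin
      length (f zero ++ concat (tabulate (f ∘ suc))) * 2 + suc n
        ≡⟨ cong (λ x → x * 2 + suc n) (length-++ (f zero)) ⟩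
      (length (f zero) + L) * 2 + suc n
        ≡⟨ cong (λ x → (x + L) * 2 + suc n) (len zero) ⟩
      (c + 0 + L) * 2 + suc n ≡⟨ rearrange (c + 0) L n ⟩
      (c + 0) * 2 + (L * 2 + n) + 1
        ≡⟨ cong (λ x → (c + 0) * 2 + x + 1)
             (triangular (f ∘ suc) (suc c) (λ i → trans (len (suc i)) (+-suc c (toℕ i)))) ⟩
      (c + 0) * 2 + n * (suc c * 2 + n) + 1 ≡⟨ arithmetic c n ⟩
      suc n * (c * 2 + suc n) ∎
      where
      open ≡-Reasoning
      L = length (concat (tabulate (f ∘ suc)))

  length-edges : length edges ≡ T * length pairs
  length-edges = uniform {n = T} (λ t → map (t ,_) pairs) (λ t → length-map (t ,_) pairs)
    where
    uniform : ∀ {n c} (f : Fin n → List A) → (∀ i → length (f i) ≡ c) →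
      length (concat (tabulate f)) ≡ n * c
    uniform {n = zero}  f len = refl
    uniform {n = suc n} f len =
      trans (length-++ (f zero)) (cong₂ _+_ (len zero) (uniform (f ∘ suc) (len ∘ suc)))

-- Words with a single block

-- The block has 2k + 2 letters, fewer than the 4k letters that two parts of a strong division would
-- need, because k is at least 4.
singleton-height : ∀ {l n} → 2 ≤ l →
  SmallSelectiveHeights (NonCyclicOfLength {l} 2) (2 * (2 + n))
    (λ W → ¬ StronglyDivisible (NonCyclicOfLength 2) (2 * (2 + n)) (2 + n) W) 1
singleton-height {suc (suc l)} {n} (s≤s (s≤s z≤n)) = spell (blowUp (suc k) (tt ∷ [])) ,
  (λ S → <⇒≱ short (stronglyDivisible-length proj₂ S)) ,
  smallSelectiveHeight (tt ∷ []) (m≤m*n 2 (2 + n)) (λ _ ())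
    (λ { {zero} {zero} i≢i → contradiction refl i≢i })
  where
  k = 2 * (2 + n)
  open Spelling {l = 2 + l} {X = ⊤} (λ _ → zero) (λ _ → suc zero)

  arithmetic : ∀ n → 2 * (2 + n) * 4 ≡ suc (suc (2 * (2 + n)) * 2) + (5 + n * 4)
  arithmetic = solve-∀

  short : length (spell (blowUp (suc k) (tt ∷ []))) < k * 4
  short = begin-strict
    length (spell (blowUp (suc k) (tt ∷ []))) ≡⟨ cong length (spell-blowUp (suc k) (tt ∷ [])) ⟩
    length (word tt ^ʷ suc k ++ []) ≡⟨ cong length (++-identityʳ (word tt ^ʷ suc k)) ⟩
    length (word tt ^ʷ suc k)       ≡⟨ length-^ʷ (word tt) (suc k) ⟩
    suc k * 2                       <⟨ m≤m+n _ _ ⟩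
    suc (suc k * 2) + (5 + n * 4)   ≡⟨ arithmetic n ⟨
    k * 4                           ∎
    where open ≤-Reasoning

-- Size of Ψ and conclusion

-- With n = 4 + m the factors n - 2 and n - 3 are positive, so the sign of Ψ is that of l - 2^(n-1).
Ψ-negative : ∀ m l → l < 2 ^ (3 + m) → Ψ (4 + m) l ℚᵘ.< fromℕ 1
Ψ-negative m l l<p
  with d , p≡ ← m≤n⇒∃[o]m+o≡n l<p
  = *<* (subst (λ x → x ℤ.* ℤ.+ (2 + m) ℤ.* ℤ.+ (1 + m) ℤ.* ℤ.+ 1 ℤ.< ℤ.+ 2) (sym negative) ℤ.-<+)
  where
  open ≡-Reasoning
  negative : ℤ.+ l ℤ.- ℤ.+ (2 ^ (3 + m)) ≡ -[1+ d ]
  negative = begin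
    ℤ.+ l ℤ.- ℤ.+ (2 ^ (3 + m)) ≡⟨ ℤ.m-n≡m⊖n l (2 ^ (3 + m)) ⟩
    l ℤ.⊖ 2 ^ (3 + m)           ≡⟨ ℤ.⊖-< l<p ⟩
    ℤ.- ℤ.+ (2 ^ (3 + m) ∸ l)   ≡⟨ cong (λ x → ℤ.- ℤ.+ (x ∸ l)) p≡ ⟨
    ℤ.- ℤ.+ (suc l + d ∸ l)     ≡⟨ cong (λ x → ℤ.- ℤ.+ (x ∸ l)) (+-suc l d) ⟨
    ℤ.- ℤ.+ (l + suc d ∸ l)     ≡⟨ cong (λ x → ℤ.- ℤ.+ x) (m+n∸m≡n l (suc d)) ⟩
    -[1+ d ]                    ∎

-- The hypothesis says that L is the number of edges of one clique on n - 2 letters. Then Ψ equals s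
-- L, so s + 1 cliques exceed it by a whole clique, and L is positive.
Ψ-bound : ∀ m s {L} → L * 2 + (2 + m) ≡ (2 + m) * (2 + m) →
  Ψ (4 + m) (2 ^ (3 + m) + s) ℚᵘ.< fromℕ (suc s * L)
Ψ-bound m s {L} eq = *<* (subst₂ ℤ._<_ (sym left) (ℤ.pos-* (suc s * L) 2)
  (ℤ.+<+ bound))
  where
  p = 2 ^ (3 + m)

  difference : ℤ.+ (p + s) ℤ.- ℤ.+ p ≡ ℤ.+ s
  difference = trans (ℤ.m-n≡m⊖n (p + s) p)
    (trans (ℤ.⊖-≥ (m≤m+n p s)) (cong ℤ.+_ (m+n∸m≡n p s)))

  left : (ℤ.+ (p + s) ℤ.- ℤ.+ p) ℤ.* ℤ.+ (2 + m) ℤ.* ℤ.+ (1 + m) ℤ.* ℤ.+ 1 ≡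
         ℤ.+ (s * (2 + m) * (1 + m))
  left = begin
    (ℤ.+ (p + s) ℤ.- ℤ.+ p) ℤ.* ℤ.+ (2 + m) ℤ.* ℤ.+ (1 + m) ℤ.* ℤ.+ 1
      ≡⟨ ℤ.*-identityʳ _ ⟩
    (ℤ.+ (p + s) ℤ.- ℤ.+ p) ℤ.* ℤ.+ (2 + m) ℤ.* ℤ.+ (1 + m)
      ≡⟨ cong (λ x → x ℤ.* ℤ.+ (2 + m) ℤ.* ℤ.+ (1 + m)) difference ⟩
    ℤ.+ s ℤ.* ℤ.+ (2 + m) ℤ.* ℤ.+ (1 + m)
      ≡⟨ cong (ℤ._* ℤ.+ (1 + m)) (ℤ.pos-* s (2 + m)) ⟨
    ℤ.+ (s * (2 + m)) ℤ.* ℤ.+ (1 + m)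
      ≡⟨ ℤ.pos-* (s * (2 + m)) (1 + m) ⟨
    ℤ.+ (s * (2 + m) * (1 + m)) ∎
    where open ≡-Reasoning

  square : ∀ m → (2 + m) * (2 + m) ≡ (2 + m) * (1 + m) + (2 + m)
  square = solve-∀

  2L : L * 2 ≡ (2 + m) * (1 + m)
  2L = +-cancelʳ-≡ (2 + m) _ _ (trans eq (square m))

  bound : s * (2 + m) * (1 + m) < suc s * L * 2
  bound = begin-strict
    s * (2 + m) * (1 + m)       ≡⟨ *-assoc s (2 + m) (1 + m) ⟩
    s * ((2 + m) * (1 + m))     <⟨ m<n+m _ (s≤s z≤n) ⟩
    suc s * ((2 + m) * (1 + m)) ≡⟨ cong (suc s *_) 2L ⟨
    suc s * (L * 2)             ≡⟨ *-assoc (suc s) L 2 ⟨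
    suc s * L * 2               ∎
    where open ≤-Reasoning

cliques-height : ∀ m s →
  let n = 4 + m
      l = 2 ^ (3 + m) + s
      Z = NonCyclicOfLength {l} 2
      k = 2 * n
  in Ψ n l <sup SmallSelectiveHeights Z k (λ W → ¬ StronglyDivisible Z k n W)
cliques-height m s =
  length edges , edges-height (m≤m*n 2 (4 + m)) (s≤s (n≤1+n _)) ,
  subst (λ h → Ψ (4 + m) (2 ^ (3 + m) + s) ℚᵘ.< fromℕ h) (sym length-edges)
    (Ψ-bound m s length-pairs)
  where
  q = 2 ^ (2 + m)

  -- The letters t + 2^γ with γ < n - 2 use only half of 2^(n-1); the other half leaves room for one
  -- shift more than s.
  fits : suc s + q ≤ 2 ^ (3 + m) + s
  fits = begin
    suc s + q         ≡⟨ +-suc s q ⟨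
    s + (1 + q)       ≤⟨ +-monoʳ-≤ s (+-mono-≤ (m^n>0 2 (2 + m)) (m≤m+n q 0)) ⟩
    s + (q + (q + 0)) ≡⟨ +-comm s _ ⟩
    2 ^ (3 + m) + s   ∎
    where open ≤-Reasoning

  open Cliques (suc s) (2 + m) fits

mainTheorem2 : (n l : ℕ) → 2 ≤ n → 2 ≤ l →
    let Z = NonCyclicOfLength {l} 2
        k = 2 * n
    in Ψ n l <sup SmallSelectiveHeights Z k (λ W → ¬ StronglyDivisible Z k n W)
mainTheorem2 (suc zero) l (s≤s ()) _
-- For n = 2 and n = 3 one factor of the numerator vanishes, so Ψ is 0 and height 1 suffices.
mainTheorem2 2 l _ 2≤l = 1 , singleton-height 2≤l ,
  *<* (subst (λ x → x ℤ.* -[1+ 0 ] ℤ.* ℤ.+ 1 ℤ.< ℤ.+ 2) (sym (ℤ.*-zeroʳ (ℤ.+ l ℤ.- ℤ.+ 2)))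
    (ℤ.+<+ (s≤s z≤n)))
mainTheorem2 3 l _ 2≤l = 1 , singleton-height 2≤l ,
  *<* (subst (λ x → x ℤ.* ℤ.+ 1 ℤ.< ℤ.+ 2)
    (sym (ℤ.*-zeroʳ ((ℤ.+ l ℤ.- ℤ.+ 4) ℤ.* ℤ.+ 1))) (ℤ.+<+ (s≤s z≤n)))
mainTheorem2 (suc (suc (suc (suc m)))) l _ 2≤l with 2 ^ (3 + m) ≤? l
... | no  p≰l = 1 , singleton-height 2≤l , Ψ-negative m l (≰⇒> p≰l)
-- Here `s` is l - 2^(n-1), the first factor of the numerator of Ψ.
... | yes p≤l with s , refl ← m≤n⇒∃[o]m+o≡n p≤l = cliques-height m s
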